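{- Let $s\ge0$ be an integer, $h\in\mathbb C\setminus\{0\}$ and $q\in\mathbb C\setminus\{0\}$. For all $0\le k\le n$, $$S_{s,h,q}[n,k]=h^{n-k}q^{s\binom n2-(s-1)\binom k2-n+k}\sum_{j=k}^n[s]_{1/q}^{\,n-j}\bigl(-[s-1]_{1/q}\bigr)^{j-k}\,\hat c_{1/q^{s}}[n,j]\,\hat S_{1/q^{s-1}}[j,k].$$ Consequently, for $q=1$, writing $S_{s,h}(n,k)=S_{s,h,1}[n,k]$, $$S_{s,h}(n,k)=h^{n-k}\sum_{j=k}^ns^{n-j}(1-s)^{j-k}c(n,j)S(j,k),$$ where $c(n,k)$ and $S(n,k)$ are the classical (unsigned) Stirling numbers of the first kind and the Stirling numbers of the second kind, respectively. (Here $0^0=1$.)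
   Context: For an integer $x$ and $p\in\mathbb C\setminus\{0\}$, $[x]_p=\frac{p^x-1}{p-1}$ if $p\ne1$ and $[x]_1=x$. The numbers $S_{s,h,q}[n,k]$ are the coefficients in $(VU)^n=\sum_{k=0}^nS_{s,h,q}[n,k]V^{sn-(s-1)k}U^k$, where $UV-qVU=hV^s$; equivalently they are determined by $S_{s,h,q}[n,k]=q^{s(n-1)-(s-1)(k-1)}S_{s,h,q}[n-1,k-1]+h[s(n-1)-(s-1)k]_q\,S_{s,h,q}[n-1,k]$ for $n,k\ge1$, with $S_{s,h,q}[n,0]=S_{s,h,q}[0,n]=\delta_{0,n}$. For $p\in\mathbb C\setminus\{0\}$, $\hat S_p$ and $\hat c_p$ are defined for $n,k\geq 1$ by $\hat S_p[n,k]=\hat S_p[n-1,k-1]+[k]_p\hat S_p[n-1,k]$ and $\hat c_p[n,k]=\hat c_p[n-1,k-1]+[n-1]_p\hat c_p[n-1,k]$, with $\hat S_p[n,0]=\hat S_p[0,n]=\hat c_p[n,0]=\hat c_p[0,n]=\delta_{n,0}$. -}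

module Defs where

open import Algebra.Apartness.Bundles using (HeytingField; HeytingCommutativeRing)
open import Algebra.Bundles using (CommutativeRing; Semiring)
import Algebra.Apartness.Properties.HeytingCommutativeRing as HeytingProperties
import Algebra.Definitions.RawSemiring as RawSemiringDefinitions
open import Data.Fin.Base using (toℕ)
open import Data.Integer.Base as ℤ using (ℤ; +_; -[1+_])
open import Data.Nat.Base as ℕ using (ℕ; zero; suc; _∸_)
open import Data.Product.Base using (∃; _,_; proj₁; proj₂)
open import Relation.Binary.Definitions using (Decidable)
open import Relation.Nullary.Decidable.Core using (yes; no)

-- The first kind is unsigned.

stirling₁ : ℕ → ℕ → ℕ
stirling₁ zero    zero    = 1
stirling₁ zero    (suc _) = 0
stirling₁ (suc _) zero    = 0
stirling₁ (suc n) (suc k) = stirling₁ n k ℕ.+ n ℕ.* stirling₁ n (suc k)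

stirling₂ : ℕ → ℕ → ℕ
stirling₂ zero    zero    = 1
stirling₂ zero    (suc _) = 0
stirling₂ (suc _) zero    = 0
stirling₂ (suc n) (suc k) = stirling₂ n k ℕ.+ suc k ℕ.* stirling₂ n (suc k)

-- Decidability of apartness makes K a field in the classical sense (x # y
-- amounts to x ≉ y); it is what the case distinction p = 1 / p ≠ 1 in [ x ] p
-- uses.  The classical field of complex numbers is an instance.

module QStirling {c ℓ₁ ℓ₂} (K : HeytingField c ℓ₁ ℓ₂)
                 (_#?_ : Decidable (HeytingField._#_ K)) where

  open HeytingField K public
    using (Carrier; _≈_; _#_; _+_; _*_; -_; _-_; 0#; 1#)
  open HeytingField K
    using ( heytingCommutativeRing; #⇒invertible; trans
          ; *-congˡ )
  open HeytingProperties heytingCommutativeRing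
    using (x-0≈x; 1#0; x#0y#0→xy#0; invertibleˡ⇒#)
  open RawSemiringDefinitions
    (Semiring.rawSemiring (CommutativeRing.semiring
      (HeytingCommutativeRing.commutativeRing heytingCommutativeRing))) public
    using (_^_; _×_; sum)

  fromℕ : ℕ → Carrier
  fromℕ n = n × 1#

  fromℤ : ℤ → Carrier
  fromℤ (+ n)    = fromℕ n
  fromℤ -[1+ n ] = - fromℕ (suc n)

  ∑ : ℕ → ℕ → (ℕ → Carrier) → Carrier
  ∑ a b f = sum {suc b ∸ a} λ i → f (a ℕ.+ toℕ i)

  syntax ∑ a b (λ j → t) = ∑[ j from a to b ] t

  K× : Set _
  K× = ∃ (_# 0#)

  infix 9 ↑_
  ↑_ : K× → Carrier
  ↑_ = proj₁

  1× : K×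
  1× = 1# , 1#0

  infix 10 _⁻¹
  _⁻¹ : K× → K×
  (x , x#0) ⁻¹ = y , invertibleˡ⇒# (x - 0# , trans (*-congˡ (x-0≈x y)) [x-0]y≈1)
    where
    -- #⇒invertible inverts x - 0#, which is x up to ≈.
    y = proj₁ (#⇒invertible x#0)
    [x-0]y≈1 = proj₂ (proj₂ (#⇒invertible x#0))

  infixr 8 _^×_ _^ᶻ_
  _^×_ : K× → ℕ → K×
  (x , x#0) ^× n = x ^ n , pow#0 n
    where
    pow#0 : ∀ n → x ^ n # 0#
    pow#0 zero    = 1#0
    pow#0 (suc n) = x#0y#0→xy#0 x#0 (pow#0 n)

  _^ᶻ_ : K× → ℤ → K×
  p ^ᶻ (+ n)    = p ^× n
  p ^ᶻ -[1+ n ] = (p ⁻¹) ^× suc n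

  infix 9 [_]_
  [_]_ : ℤ → K× → Carrier
  [ x ] p with (↑ p) #? 1#
  ... | yes p#1 = (↑ (p ^ᶻ x) - 1#) * proj₁ (#⇒invertible p#1)
  ... | no  _   = fromℤ x

  -- The coefficients of the normal ordering
  --   (V U)ⁿ = ∑ₖ S s h q n k · V^(s n - (s - 1) k) · U^k
  -- where U V - q V U = h V^s, given by their recurrence.
  S : ℕ → Carrier → K× → ℕ → ℕ → Carrier
  S s h q zero    zero    = 1#
  S s h q zero    (suc _) = 0#
  S s h q (suc _) zero    = 0#
  S s h q (suc n) (suc k) =
    ↑ (q ^ᶻ (+ s ℤ.* + n ℤ.- (+ s ℤ.- + 1) ℤ.* + k)) * S s h q n k
    + h * [ + s ℤ.* + n ℤ.- (+ s ℤ.- + 1) ℤ.* + suc k ] q * S s h q n (suc k)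

  Ŝ : K× → ℕ → ℕ → Carrier
  Ŝ p zero    zero    = 1#
  Ŝ p zero    (suc _) = 0#
  Ŝ p (suc _) zero    = 0#
  Ŝ p (suc n) (suc k) = Ŝ p n k + [ + suc k ] p * Ŝ p n (suc k)

  ĉ : K× → ℕ → ℕ → Carrier
  ĉ p zero    zero    = 1#
  ĉ p zero    (suc _) = 0#
  ĉ p (suc _) zero    = 0#
  ĉ p (suc n) (suc k) = ĉ p n k + [ + n ] p * ĉ p n (suc k)

{-# OPTIONS --safe #-}

-- Call an array a (v , w)-triangle if it satisfies
--   A (n + 1) (k + 1) = v n k · A n k + w n (k + 1) · A n (k + 1)
-- with the usual boundary values; v and w determine it.  If A has weights
-- (1 , α n) and B has weights (1 , β k), then the matrix product A B has
-- weights (1 , α n + β k).  With p = 1/q, the factors [s]_p^(n-j) and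
-- (-[s-1]_p)^(j-k) rescale ĉ and Ŝ to the weights [s n]_p and -[(s-1) k]_p,
-- whose sum is a power of q times [s n - (s-1) k]_q.  Rescaling by the
-- prefactor h^(n-k) q^(...) turns these into the weights of S.
-- For q = 1 the same argument applies to the classical Stirling numbers.

module Submission where

open import Defs
open import Algebra.Apartness.Bundles using (HeytingField; HeytingCommutativeRing)
open import Algebra.Bundles using (CommutativeRing; CommutativeSemiring)
import Algebra.Properties.CommutativeSemiring.Exp as Exp
import Algebra.Properties.Ring as RingProperties
import Algebra.Properties.Semiring.Mult as Mult
import Algebra.Properties.Semiring.Sum as Sum
import Algebra.Solver.Ring.NaturalCoefficients.Default as Solver
open import Data.Empty using (⊥-elim)
open import Data.Fin.Base using (toℕ)
open import Data.Integer.Base as ℤ using (ℤ; +_; -[1+_])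
import Data.Integer.Properties as ℤ
open import Data.Integer.Tactic.RingSolver using (solve-∀)
open import Data.Nat.Base as ℕ using (ℕ; zero; suc; _≤_; _<_; _∸_; z≤n; s≤s)
open import Data.Nat.Combinatorics using (_C_; nC1≡n; nCk+nC[k+1]≡[n+1]C[k+1])
import Data.Nat.Properties as ℕ
open import Data.Product.Base using (_,_; proj₁; proj₂) renaming (_×_ to _∧_)
open import Data.Sum.Base using (inj₁; inj₂)
open import Function.Base using (_∘_)
open import Relation.Binary.Definitions using (Decidable)
open import Relation.Binary.PropositionalEquality as ≡ using (_≡_)
import Relation.Binary.Reasoning.Setoid as SetoidReasoning
open import Relation.Nullary.Decidable.Core using (yes; no)

-- Weighted triangles over a commutative semiring.

module WeightedTriangle {c ℓ} (R : CommutativeSemiring c ℓ) where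

  open CommutativeSemiring R
  open Exp R using (_^_)
  open Sum semiring using (sum; sum-cong-≋; *-distribˡ-sum; ∑-distrib-+; sum-replicate-zero)
  open Solver R using (solve; _:=_; _:+_; _:*_; con)
  open SetoidReasoning setoid

  ∑< : ℕ → (ℕ → Carrier) → Carrier
  ∑< n f = sum {n} (f ∘ toℕ)

  ∑<-last : ∀ n f → ∑< (suc n) f ≈ ∑< n f + f n
  ∑<-last zero    f = +-comm (f 0) 0#
  ∑<-last (suc n) f = begin
    f 0 + ∑< (suc n) (f ∘ suc)           ≈⟨ +-congˡ (∑<-last n (f ∘ suc)) ⟩
    f 0 + (∑< n (f ∘ suc) + f (suc n))   ≈⟨ +-assoc _ _ _ ⟨
    f 0 + ∑< n (f ∘ suc) + f (suc n)     ∎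

  ∑<-zero : ∀ n f → (∀ j → f j ≈ 0#) → ∑< n f ≈ 0#
  ∑<-zero n f f≈0 = trans (sum-cong-≋ {n} (λ i → f≈0 (toℕ i))) (sum-replicate-zero n)

  -- Each weight is indexed by the position of the entry in row n that it multiplies, hence `v n k`
  -- but `w n (suc k)`.
  record IsTriangle (v w A : ℕ → ℕ → Carrier) : Set ℓ where
    field
      corner : A 0 0 ≈ 1#
      top    : ∀ k → A 0 (suc k) ≈ 0#
      left   : ∀ n → A (suc n) 0 ≈ 0#
      step   : ∀ n k → A (suc n) (suc k) ≈ v n k * A n k + w n (suc k) * A n (suc k)

    above : ∀ {n k} → n < k → A n k ≈ 0#
    above {zero}  {suc k} _         = top k
    above {suc n} {suc k} (s≤s n<k) = begin
      A (suc n) (suc k)                        ≈⟨ step n k ⟩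
      v n k * A n k + w n (suc k) * A n (suc k) ≈⟨ +-cong (*-congˡ (above n<k)) (*-congˡ (above (ℕ.m<n⇒m<1+n n<k))) ⟩
      v n k * 0# + w n (suc k) * 0#            ≈⟨ +-cong (zeroʳ _) (zeroʳ _) ⟩
      0# + 0#                                  ≈⟨ +-identityˡ 0# ⟩
      0#                                       ∎

  1ʷ : ℕ → ℕ → Carrier
  1ʷ _ _ = 1#

  module _ {v w A : ℕ → ℕ → Carrier} (▵A : IsTriangle v w A) where

    open IsTriangle ▵A

    unique : ∀ {B} → IsTriangle v w B → ∀ n k → A n k ≈ B n k
    unique ▵B zero    zero    = trans corner (sym (IsTriangle.corner ▵B))
    unique ▵B zero    (suc k) = trans (top k) (sym (IsTriangle.top ▵B k))
    unique ▵B (suc n) zero    = trans (left n) (sym (IsTriangle.left ▵B n))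
    unique ▵B (suc n) (suc k) =
      trans (step n k) (trans (+-cong (*-congˡ (unique ▵B n k)) (*-congˡ (unique ▵B n (suc k))))
        (sym (IsTriangle.step ▵B n k)))

    -- The second condition is only needed below the diagonal because A
    -- vanishes above it; this is what makes truncated exponents n ∸ k harmless.
    rescale : ∀ {v′ w′} (g : ℕ → ℕ → Carrier) → g 0 0 ≈ 1# →
              (∀ n k → g (suc n) (suc k) * v n k ≈ v′ n k * g n k) →
              (∀ n k → k < n → g (suc n) (suc k) * w n (suc k) ≈ w′ n (suc k) * g n (suc k)) →
              IsTriangle v′ w′ (λ n k → g n k * A n k)
    rescale {v′} {w′} g g₀ gᵛ gʷ = record
      { corner = trans (*-cong g₀ corner) (*-identityˡ 1#)
      ; top    = λ k → trans (*-congˡ (top k)) (zeroʳ _)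
      ; left   = λ n → trans (*-congˡ (left n)) (zeroʳ _)
      ; step   = λ n k → begin
          g (suc n) (suc k) * A (suc n) (suc k)
            ≈⟨ *-congˡ (step n k) ⟩
          g (suc n) (suc k) * (v n k * A n k + w n (suc k) * A n (suc k))
            ≈⟨ distribˡ _ _ _ ⟩
          g (suc n) (suc k) * (v n k * A n k) + g (suc n) (suc k) * (w n (suc k) * A n (suc k))
            ≈⟨ +-cong (exchange (gᵛ n k)) (second n k) ⟩
          v′ n k * (g n k * A n k) + w′ n (suc k) * (g n (suc k) * A n (suc k))
            ∎
      }
      where
      exchange : ∀ {a b c d x} → a * b ≈ c * d → a * (b * x) ≈ c * (d * x)
      exchange eq = trans (sym (*-assoc _ _ _)) (trans (*-congʳ eq) (*-assoc _ _ _))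

      second : ∀ n k → g (suc n) (suc k) * (w n (suc k) * A n (suc k))
                     ≈ w′ n (suc k) * (g n (suc k) * A n (suc k))
      second n k with ℕ.≤-<-connex n k
      ... | inj₂ k<n = exchange (gʷ n k k<n)
      ... | inj₁ n≤k = trans (vanish _ _) (sym (vanish _ _))
        where
        vanish : ∀ x y → x * (y * A n (suc k)) ≈ 0#
        vanish x y = trans (*-congˡ (trans (*-congˡ (above (s≤s n≤k))) (zeroʳ y))) (zeroʳ x)

  -- A diagonal step leaves the exponent `n ∸ k` unchanged, and a step that keeps the column raises
  -- it by one; so only `w` acquires a factor `a`.
  rescale-^ : ∀ {w A} → IsTriangle 1ʷ w A → ∀ a →
              IsTriangle 1ʷ (λ n k → a * w n k) (λ n k → a ^ (n ∸ k) * A n k)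
  rescale-^ {w} ▵A a = rescale ▵A (λ n k → a ^ (n ∸ k)) refl (λ n k → *-comm _ _) λ n k k<n → begin
    a ^ (n ∸ k) * w n (suc k)               ≡⟨ ≡.cong (λ m → a ^ m * w n (suc k)) (ℕ.+-∸-assoc 1 k<n) ⟩
    a * a ^ (n ∸ suc k) * w n (suc k)       ≈⟨ solve 3 (λ a b w → a :* b :* w := a :* w :* b) refl a _ _ ⟩
    a * w n (suc k) * a ^ (n ∸ suc k)       ∎

  -- The weight `α n` depends only on the row of A and `β k` only on the column of B, so neither
  -- involves the summation index and both can be pulled out of the sum.
  compose : ∀ {α β : ℕ → Carrier} {A B} →
            IsTriangle 1ʷ (λ n _ → α n) A → IsTriangle 1ʷ (λ _ k → β k) B →
            IsTriangle 1ʷ (λ n k → α n + β k) (λ n k → ∑< (suc n) (λ j → A n j * B j k))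
  compose {α} {β} {A} {B} ▵A ▵B = record
    { corner = trans (+-identityʳ _) (trans (*-cong A.corner B.corner) (*-identityˡ 1#))
    ; top    = λ k → trans (+-identityʳ _) (trans (*-congˡ (B.top k)) (zeroʳ _))
    ; left   = λ n → ∑<-zero (suc (suc n)) (λ j → A (suc n) j * B j 0) λ
        { zero    → trans (*-congʳ (A.left n)) (zeroˡ _)
        ; (suc j) → trans (*-congˡ (B.left j)) (zeroʳ _) }
    ; step   = step
    }
    where
    module A = IsTriangle ▵A
    module B = IsTriangle ▵B

    T : ℕ → ℕ → Carrier
    T n k = ∑< (suc n) (λ j → A n j * B j k)

    -- After the recurrence of A, only the summand with `A n j` has its B factor expanded; the other
    -- keeps the index j + 1 in both factors, ready for `shifted`.
    term : ∀ n k j → A (suc n) (suc j) * B (suc j) (suc k)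
         ≈ A n j * B j k + (β (suc k) * (A n j * B j (suc k)) + α n * (A n (suc j) * B (suc j) (suc k)))
    term n k j = begin
      A (suc n) (suc j) * B (suc j) (suc k)
        ≈⟨ *-congʳ (A.step n j) ⟩
      (1# * A n j + α n * A n (suc j)) * B (suc j) (suc k)
        ≈⟨ solve 4 (λ a α a′ b → (con 1 :* a :+ α :* a′) :* b := a :* b :+ α :* (a′ :* b)) refl _ _ _ _ ⟩
      A n j * B (suc j) (suc k) + α n * (A n (suc j) * B (suc j) (suc k))
        ≈⟨ +-congʳ (*-congˡ (B.step j k)) ⟩
      A n j * (1# * B j k + β (suc k) * B j (suc k)) + α n * (A n (suc j) * B (suc j) (suc k))
        ≈⟨ solve 5 (λ a b β b′ x → a :* (con 1 :* b :+ β :* b′) :+ x := a :* b :+ (β :* (a :* b′) :+ x)) refl _ _ _ _ _ ⟩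
      A n j * B j k + (β (suc k) * (A n j * B j (suc k)) + α n * (A n (suc j) * B (suc j) (suc k)))
        ∎

    -- The shift loses the term at 0 and gains the one at n + 1. The former vanishes by the top row
    -- of B, the latter because A is zero above the diagonal.
    shifted : ∀ n k → ∑< (suc n) (λ j → A n (suc j) * B (suc j) (suc k)) ≈ T n (suc k)
    shifted n k = begin
      ∑< (suc n) (f ∘ suc)         ≈⟨ +-identityˡ _ ⟨
      0# + ∑< (suc n) (f ∘ suc)    ≈⟨ +-congʳ (trans (*-congˡ (B.top k)) (zeroʳ _)) ⟨
      ∑< (suc (suc n)) f           ≈⟨ ∑<-last (suc n) f ⟩
      ∑< (suc n) f + f (suc n)     ≈⟨ +-congˡ (trans (*-congʳ (A.above ℕ.≤-refl)) (zeroˡ _)) ⟩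
      ∑< (suc n) f + 0#            ≈⟨ +-identityʳ _ ⟩
      T n (suc k)                  ∎
      where
      f : ℕ → Carrier
      f j = A n j * B j (suc k)

    step : ∀ n k → T (suc n) (suc k) ≈ 1# * T n k + (α n + β (suc k)) * T n (suc k)
    step n k = begin
      A (suc n) 0 * B 0 (suc k) + ∑< (suc n) (λ j → A (suc n) (suc j) * B (suc j) (suc k))
        ≈⟨ +-congʳ (trans (*-congʳ (A.left n)) (zeroˡ _)) ⟩
      0# + ∑< (suc n) (λ j → A (suc n) (suc j) * B (suc j) (suc k))
        ≈⟨ +-identityˡ _ ⟩
      ∑< (suc n) (λ j → A (suc n) (suc j) * B (suc j) (suc k))
        ≈⟨ sum-cong-≋ {suc n} (λ i → term n k (toℕ i)) ⟩
      ∑< (suc n) (λ j → f j + (β (suc k) * g j + α n * h j))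
        ≈⟨ ∑-distrib-+ {suc n} (f ∘ toℕ) (λ i → β (suc k) * g (toℕ i) + α n * h (toℕ i)) ⟩
      T n k + ∑< (suc n) (λ j → β (suc k) * g j + α n * h j)
        ≈⟨ +-congˡ (∑-distrib-+ {suc n} (λ i → β (suc k) * g (toℕ i)) (λ i → α n * h (toℕ i))) ⟩
      T n k + (∑< (suc n) (λ j → β (suc k) * g j) + ∑< (suc n) (λ j → α n * h j))
        ≈⟨ +-congˡ (+-cong (*-distribˡ-sum {suc n} (β (suc k)) (g ∘ toℕ)) (*-distribˡ-sum {suc n} (α n) (h ∘ toℕ))) ⟨
      T n k + (β (suc k) * T n (suc k) + α n * ∑< (suc n) h)
        ≈⟨ +-congˡ (+-congˡ (*-congˡ (shifted n k))) ⟩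
      T n k + (β (suc k) * T n (suc k) + α n * T n (suc k))
        ≈⟨ solve 4 (λ t β α t′ → t :+ (β :* t′ :+ α :* t′) := con 1 :* t :+ (α :+ β) :* t′) refl _ _ _ _ ⟩
      1# * T n k + (α n + β (suc k)) * T n (suc k)
        ∎
      where
      f g h : ℕ → Carrier
      f j = A n j * B j k
      g j = A n j * B j (suc k)
      h j = A n (suc j) * B (suc j) (suc k)

-- Binomial coefficients and induction on integers.

binomial₂-suc : ∀ n → + (suc n C 2) ≡ + n ℤ.+ + (n C 2)
binomial₂-suc n = ≡.cong +_ (≡.trans (≡.sym (nCk+nC[k+1]≡[n+1]C[k+1] n 1)) (≡.cong (ℕ._+ n C 2) (nC1≡n n)))

-- The downward step is also phrased with `ℤ.suc`, so that one recurrence can serve both directions.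
ℤ-induction : ∀ {ℓ} (P : ℤ → Set ℓ) → P (+ 0) → (∀ x → P x → P (ℤ.suc x)) →
              (∀ x → P (ℤ.suc x) → P x) → ∀ x → P x
ℤ-induction P P₀ up down (+ zero)       = P₀
ℤ-induction P P₀ up down (+ suc n)      = up (+ n) (ℤ-induction P P₀ up down (+ n))
ℤ-induction P P₀ up down -[1+ zero ]    = down -[1+ 0 ] P₀
ℤ-induction P P₀ up down -[1+ suc n ]   = down -[1+ suc n ] (ℤ-induction P P₀ up down -[1+ n ])

module _ {c ℓ₁ ℓ₂} (K : HeytingField c ℓ₁ ℓ₂) (_#?_ : Decidable (HeytingField._#_ K)) where

  open HeytingField K
  open QStirling K _#?_ hiding (Carrier; _≈_; _#_; _+_; _*_; -_; _-_; 0#; 1#)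
  open CommutativeRing (HeytingCommutativeRing.commutativeRing heytingCommutativeRing)
    using (ring; semiring; commutativeSemiring)
  open RingProperties ring
    using (-‿distribˡ-*; -0#≈0#; -‿+-comm; xyx⁻¹≈y; +-cancelˡ)
  open Mult semiring using (×-homo-+; ×1-homo-*)
  open Sum semiring using (sum-cong-≋)
  open WeightedTriangle commutativeSemiring
  open Solver commutativeSemiring using (solve; _:=_; _:+_; _:*_; con)
  open SetoidReasoning setoid

  -- Inverses and integer powers.

  ⁻¹-inverseˡ : ∀ p → ↑ (p ⁻¹) * ↑ p ≈ 1#
  ⁻¹-inverseˡ (x , x#0) =
    trans (*-congˡ (sym (trans (+-congˡ -0#≈0#) (+-identityʳ x)))) (proj₁ (proj₂ (#⇒invertible x#0)))

  ⁻¹-inverseʳ : ∀ p → ↑ p * ↑ (p ⁻¹) ≈ 1#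
  ⁻¹-inverseʳ p = trans (*-comm _ _) (⁻¹-inverseˡ p)

  *-cancelˡ : ∀ p {x y} → ↑ p * x ≈ ↑ p * y → x ≈ y
  *-cancelˡ p {x} {y} px≈py = begin
    x                        ≈⟨ undo x ⟨
    ↑ (p ⁻¹) * (↑ p * x)     ≈⟨ *-congˡ px≈py ⟩
    ↑ (p ⁻¹) * (↑ p * y)     ≈⟨ undo y ⟩
    y                        ∎
    where
    undo : ∀ z → ↑ (p ⁻¹) * (↑ p * z) ≈ z
    undo z = trans (sym (*-assoc _ _ _)) (trans (*-congʳ (⁻¹-inverseˡ p)) (*-identityˡ z))

  -- Since `a` is invertible, the recurrence can also be run downwards, so the value at 0 fixes the
  -- function on all integers. Several identities below follow by checking that both sides obey one
  -- such recurrence, which avoids splitting on signs.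
  affine-unique : ∀ a b {F G : ℤ → Carrier} → F (+ 0) ≈ G (+ 0) →
                  (∀ x → F (ℤ.suc x) ≈ b + ↑ a * F x) →
                  (∀ x → G (ℤ.suc x) ≈ b + ↑ a * G x) → ∀ x → F x ≈ G x
  affine-unique a b {F} {G} F₀≈G₀ F-suc G-suc = ℤ-induction (λ x → F x ≈ G x) F₀≈G₀
    (λ x Fx≈Gx → trans (F-suc x) (trans (+-congˡ (*-congˡ Fx≈Gx)) (sym (G-suc x))))
    (λ x F≈G → *-cancelˡ a (+-cancelˡ b _ _ (trans (sym (F-suc x)) (trans F≈G (G-suc x)))))

  ^ᶻ-suc : ∀ p x → ↑ (p ^ᶻ ℤ.suc x) ≈ ↑ p * ↑ (p ^ᶻ x)
  ^ᶻ-suc p (+ n)        = refl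
  ^ᶻ-suc p -[1+ zero ]  = sym (trans (*-congˡ (*-identityʳ _)) (⁻¹-inverseʳ p))
  ^ᶻ-suc p -[1+ suc n ] = sym (trans (sym (*-assoc _ _ _)) (trans (*-congʳ (⁻¹-inverseʳ p)) (*-identityˡ _)))

  ^ᶻ-+ : ∀ p x y → ↑ (p ^ᶻ (x ℤ.+ y)) ≈ ↑ (p ^ᶻ x) * ↑ (p ^ᶻ y)
  ^ᶻ-+ p x y = affine-unique p 0#
    (trans (reflexive (≡.cong (λ z → ↑ (p ^ᶻ z)) (ℤ.+-identityˡ y))) (sym (*-identityˡ _)))
    (λ x → trans (reflexive (≡.cong (λ z → ↑ (p ^ᶻ z)) (ℤ.+-assoc (+ 1) x y)))
      (trans (^ᶻ-suc p (x ℤ.+ y)) (sym (+-identityˡ _))))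
    (λ x → trans (*-congʳ (^ᶻ-suc p x)) (trans (*-assoc _ _ _) (sym (+-identityˡ _))))
    x

  1^ᶻ : ∀ x → ↑ (1× ^ᶻ x) ≈ 1#
  1^ᶻ = affine-unique 1× 0# refl
    (λ x → trans (^ᶻ-suc 1× x) (sym (+-identityˡ _)))
    (λ x → sym (trans (+-identityˡ _) (*-identityˡ 1#)))

  ^ᶻ-⁻¹-inverse : ∀ q x → ↑ (q ^ᶻ x) * ↑ (q ⁻¹ ^ᶻ x) ≈ 1#
  -- With ratio 1 and shift 0 the recurrence says that the product does not change with the
  -- exponent.
  ^ᶻ-⁻¹-inverse q = affine-unique 1× 0# (*-identityˡ 1#)
    (λ x → begin
      ↑ (q ^ᶻ ℤ.suc x) * ↑ (q ⁻¹ ^ᶻ ℤ.suc x)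
        ≈⟨ *-cong (^ᶻ-suc q x) (^ᶻ-suc (q ⁻¹) x) ⟩
      (↑ q * ↑ (q ^ᶻ x)) * (↑ (q ⁻¹) * ↑ (q ⁻¹ ^ᶻ x))
        ≈⟨ solve 4 (λ a b c d → (a :* b) :* (c :* d) := (a :* c) :* (b :* d)) refl _ _ _ _ ⟩
      (↑ q * ↑ (q ⁻¹)) * (↑ (q ^ᶻ x) * ↑ (q ⁻¹ ^ᶻ x))
        ≈⟨ *-congʳ (⁻¹-inverseʳ q) ⟩
      1# * (↑ (q ^ᶻ x) * ↑ (q ⁻¹ ^ᶻ x))
        ≈⟨ +-identityˡ _ ⟨
      0# + 1# * (↑ (q ^ᶻ x) * ↑ (q ⁻¹ ^ᶻ x))
        ∎)
    (λ x → sym (trans (+-identityˡ _) (*-identityˡ 1#)))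

  -- Both sides are inverse to `q ^ᶻ x`. This turns the bases of `ĉ` and `Ŝ` in the theorem into
  -- powers of 1/q, as `weight` requires.
  ^ᶻ-⁻¹ : ∀ q x → ↑ ((q ^ᶻ x) ⁻¹) ≈ ↑ (q ⁻¹ ^ᶻ x)
  ^ᶻ-⁻¹ q x = *-cancelˡ (q ^ᶻ x) (trans (⁻¹-inverseʳ (q ^ᶻ x)) (sym (^ᶻ-⁻¹-inverse q x)))

  -- Arithmetic of q-numbers.

  fromℤ-suc : ∀ x → fromℤ (ℤ.suc x) ≈ 1# + fromℤ x
  fromℤ-suc (+ n)        = refl
  fromℤ-suc -[1+ n ]     = trans (lemma n) (trans (sym (xyx⁻¹≈y 1# _))
      (trans (+-assoc _ _ _) (+-congˡ (trans (+-comm _ _) (-‿+-comm 1# _)))))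
    where
    lemma : ∀ n → fromℤ (ℤ.suc -[1+ n ]) ≈ - fromℕ n
    lemma zero    = sym -0#≈0#
    lemma (suc n) = refl

  [0] : ∀ p → [ + 0 ] p ≈ 0#
  [0] p with (↑ p) #? 1#
  ... | yes _ = trans (*-congʳ (-‿inverseʳ 1#)) (zeroˡ _)
  ... | no  _ = refl

  -- Together with `[0]` this absorbs the case distinction p = 1 or p ≠ 1; of the later proofs only
  -- `[x]1` looks at it again.
  [suc] : ∀ p x → [ ℤ.suc x ] p ≈ 1# + ↑ p * [ x ] p
  [suc] p x with (↑ p) #? 1#
  ... | yes p#1 = begin
    (↑ (p ^ᶻ ℤ.suc x) - 1#) * u
      ≈⟨ *-congʳ (+-congʳ (^ᶻ-suc p x)) ⟩
    (↑ p * ↑ (p ^ᶻ x) - 1#) * u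
      ≈⟨ +-identityʳ _ ⟨
    (↑ p * ↑ (p ^ᶻ x) - 1#) * u + 0#
      -- With -1 read as an atom `m`, the two sides differ by p u (1 + m). Adding this zero term
      -- makes the next step a semiring identity.
      ≈⟨ +-congˡ (trans (*-congˡ (-‿inverseʳ 1#)) (zeroʳ _)) ⟨
    (↑ p * ↑ (p ^ᶻ x) - 1#) * u + ↑ p * u * (1# - 1#)
      ≈⟨ solve 4 (λ p P m u → (p :* P :+ m) :* u :+ p :* u :* (con 1 :+ m)
                              := u :* (p :+ m) :+ p :* ((P :+ m) :* u)) refl _ _ _ _ ⟩
    u * (↑ p - 1#) + ↑ p * ((↑ (p ^ᶻ x) - 1#) * u)
      ≈⟨ +-congʳ (proj₁ (proj₂ (#⇒invertible p#1))) ⟩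
    1# + ↑ p * ((↑ (p ^ᶻ x) - 1#) * u)
      ∎
    where
    u = proj₁ (#⇒invertible p#1)
  -- Tightness turns non-apartness into p ≈ 1, so the factor `↑ p` disappears.
  ... | no ¬p#1 = trans (fromℤ-suc x)
    (+-congˡ (sym (trans (*-congʳ (proj₁ (tight _ _) ¬p#1)) (*-identityˡ _))))

  [1] : ∀ p → [ + 1 ] p ≈ 1#
  [1] p = trans ([suc] p (+ 0)) (trans (+-congˡ (trans (*-congˡ ([0] p)) (zeroʳ _))) (+-identityʳ 1#))

  -- For fixed y, both sides as functions of x obey the recurrence of `[suc]`, with shift 1 and
  -- ratio p.
  [+] : ∀ p x y → [ x ℤ.+ y ] p ≈ [ x ] p + ↑ (p ^ᶻ x) * [ y ] p
  [+] p x y = affine-unique p 1#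
    (trans (reflexive (≡.cong ([_] p) (ℤ.+-identityˡ y)))
      (sym (trans (+-cong ([0] p) (*-identityˡ _)) (+-identityˡ _))))
    (λ x → trans (reflexive (≡.cong ([_] p) (ℤ.+-assoc (+ 1) x y))) ([suc] p (x ℤ.+ y)))
    (λ x → trans (+-cong ([suc] p x) (*-congʳ (^ᶻ-suc p x)))
      (solve 4 (λ p b P c → (con 1 :+ p :* b) :+ (p :* P) :* c := con 1 :+ p :* (b :+ P :* c)) refl _ _ _ _))
    x

  [-] : ∀ p x y → [ x ] p - [ y ] p ≈ ↑ (p ^ᶻ y) * [ x ℤ.- y ] p
  [-] p x y = begin
    [ x ] p - [ y ] p
      ≡⟨ ≡.cong (λ z → [ z ] p - [ y ] p) (x≡y+[x-y] x y) ⟩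
    [ y ℤ.+ (x ℤ.- y) ] p - [ y ] p
      ≈⟨ +-congʳ ([+] p y (x ℤ.- y)) ⟩
    [ y ] p + ↑ (p ^ᶻ y) * [ x ℤ.- y ] p - [ y ] p
      ≈⟨ xyx⁻¹≈y _ _ ⟩
    ↑ (p ^ᶻ y) * [ x ℤ.- y ] p
      ∎
    where
    x≡y+[x-y] : ∀ x y → x ≡ y ℤ.+ (x ℤ.- y)
    x≡y+[x-y] = solve-∀

  -- Cutting x k into k blocks of length x gives a geometric sum with ratio p^x. The base `r` equals
  -- p^x only up to `≈`, because the theorem supplies it as the inverse of a power of q.
  [*] : ∀ p x r → ↑ r ≈ ↑ (p ^ᶻ x) → ∀ k → [ x ] p * [ + k ] r ≈ [ x ℤ.* + k ] p
  [*] p x r r≈pˣ zero = begin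
    [ x ] p * [ + 0 ] r   ≈⟨ *-congˡ ([0] r) ⟩
    [ x ] p * 0#          ≈⟨ zeroʳ _ ⟩
    0#                    ≈⟨ [0] p ⟨
    [ + 0 ] p             ≡⟨ ≡.cong ([_] p) (ℤ.*-zeroʳ x) ⟨
    [ x ℤ.* + 0 ] p       ∎
  [*] p x r r≈pˣ (suc k) = begin
    [ x ] p * [ + suc k ] r
      ≈⟨ *-congˡ ([suc] r (+ k)) ⟩
    [ x ] p * (1# + ↑ r * [ + k ] r)
      ≈⟨ solve 3 (λ x r k → x :* (con 1 :+ r :* k) := x :+ r :* (x :* k)) refl _ _ _ ⟩
    [ x ] p + ↑ r * ([ x ] p * [ + k ] r)
      ≈⟨ +-congˡ (*-cong r≈pˣ ([*] p x r r≈pˣ k)) ⟩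
    [ x ] p + ↑ (p ^ᶻ x) * [ x ℤ.* + k ] p
      ≈⟨ [+] p x (x ℤ.* + k) ⟨
    [ x ℤ.+ x ℤ.* + k ] p
      ≡⟨ ≡.cong ([_] p) (ℤ.*-suc x (+ k)) ⟨
    [ x ℤ.* + suc k ] p
      ∎

  -- This is the inversion rule [x]_q = q^(x-1) [x]_(1/q) multiplied by q. Both sides obey F(x+1) =
  -- q + q F(x).
  [⁻¹] : ∀ q x → ↑ q * [ x ] q ≈ ↑ (q ^ᶻ x) * [ x ] (q ⁻¹)
  [⁻¹] q = affine-unique q (↑ q)
    (trans (trans (*-congˡ ([0] q)) (zeroʳ _)) (sym (trans (*-congˡ ([0] (q ⁻¹))) (zeroʳ _))))
    (λ x → trans (*-congˡ ([suc] q x)) (solve 2 (λ q b → q :* (con 1 :+ q :* b) := q :+ q :* (q :* b)) refl _ _))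
    (λ x → begin
      ↑ (q ^ᶻ ℤ.suc x) * [ ℤ.suc x ] (q ⁻¹)
        ≈⟨ *-cong (^ᶻ-suc q x) ([suc]′ x) ⟩
      (↑ q * ↑ (q ^ᶻ x)) * ([ x ] (q ⁻¹) + ↑ (q ⁻¹ ^ᶻ x))
        ≈⟨ solve 4 (λ q Q b P → (q :* Q) :* (b :+ P) := q :* (Q :* P) :+ q :* (Q :* b)) refl _ _ _ _ ⟩
      ↑ q * (↑ (q ^ᶻ x) * ↑ (q ⁻¹ ^ᶻ x)) + ↑ q * (↑ (q ^ᶻ x) * [ x ] (q ⁻¹))
        ≈⟨ +-congʳ (trans (*-congˡ (^ᶻ-⁻¹-inverse q x)) (*-identityʳ _)) ⟩
      ↑ q + ↑ q * (↑ (q ^ᶻ x) * [ x ] (q ⁻¹))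
        ∎)
    where
    -- Unlike `[suc]`, this adds the new term at the top end, where it cancels against the power of
    -- q in front.
    [suc]′ : ∀ x → [ ℤ.suc x ] (q ⁻¹) ≈ [ x ] (q ⁻¹) + ↑ (q ⁻¹ ^ᶻ x)
    [suc]′ x = begin
      [ ℤ.suc x ] (q ⁻¹)                                  ≡⟨ ≡.cong ([_] (q ⁻¹)) (ℤ.+-comm (+ 1) x) ⟩
      [ x ℤ.+ + 1 ] (q ⁻¹)                                ≈⟨ [+] (q ⁻¹) x (+ 1) ⟩
      [ x ] (q ⁻¹) + ↑ (q ⁻¹ ^ᶻ x) * [ + 1 ] (q ⁻¹)       ≈⟨ +-congˡ (trans (*-congˡ ([1] (q ⁻¹))) (*-identityʳ _)) ⟩
      [ x ] (q ⁻¹) + ↑ (q ⁻¹ ^ᶻ x)                        ∎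

  [x]1 : ∀ x → [ x ] 1× ≈ fromℤ x
  [x]1 x with 1# #? 1#
  ... | yes 1#1 = ⊥-elim (#-irrefl refl 1#1)
  ... | no  _   = refl

  -- By `[*]` the two scaling factors bring the bases `r` and `t` to the common base `p`; the sign
  -- then makes the sum a difference of q-numbers, to which `[-]` applies.
  weight : ∀ p x y r t → ↑ r ≈ ↑ (p ^ᶻ x) → ↑ t ≈ ↑ (p ^ᶻ y) → ∀ n k →
           [ x ] p * [ + n ] r + - [ y ] p * [ + k ] t
             ≈ ↑ (p ^ᶻ (y ℤ.* + k)) * [ x ℤ.* + n ℤ.- y ℤ.* + k ] p
  weight p x y r t r≈pˣ t≈pʸ n k = begin
    [ x ] p * [ + n ] r + - [ y ] p * [ + k ] t
      ≈⟨ +-cong ([*] p x r r≈pˣ n) (trans (sym (-‿distribˡ-* _ _)) (-‿cong ([*] p y t t≈pʸ k))) ⟩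
    [ x ℤ.* + n ] p - [ y ℤ.* + k ] p
      ≈⟨ [-] p (x ℤ.* + n) (y ℤ.* + k) ⟩
    ↑ (p ^ᶻ (y ℤ.* + k)) * [ x ℤ.* + n ℤ.- y ℤ.* + k ] p
      ∎

  -- The arrays of the theorem as triangles.

  S-triangle : ∀ s h q → IsTriangle (λ n k → ↑ (q ^ᶻ (+ s ℤ.* + n ℤ.- (+ s ℤ.- + 1) ℤ.* + k)))
                 (λ n k → h * [ + s ℤ.* + n ℤ.- (+ s ℤ.- + 1) ℤ.* + k ] q) (S s h q)
  S-triangle s h q = record
    { corner = refl ; top = λ _ → refl ; left = λ _ → refl ; step = λ _ _ → refl }

  Ŝ-triangle : ∀ p → IsTriangle 1ʷ (λ _ k → [ + k ] p) (Ŝ p)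
  Ŝ-triangle p = record
    { corner = refl ; top = λ _ → refl ; left = λ _ → refl ; step = λ _ _ → +-congʳ (sym (*-identityˡ _)) }

  ĉ-triangle : ∀ p → IsTriangle 1ʷ (λ n _ → [ + n ] p) (ĉ p)
  ĉ-triangle p = record
    { corner = refl ; top = λ _ → refl ; left = λ _ → refl ; step = λ _ _ → +-congʳ (sym (*-identityˡ _)) }

  -- The integer weight m is written as `[ m ] 1×`, so that `weight` at p = 1 also covers the
  -- classical Stirling numbers.
  fromℕ-step : ∀ a m b → fromℕ (a ℕ.+ m ℕ.* b) ≈ 1# * fromℕ a + [ + m ] 1× * fromℕ b
  fromℕ-step a m b = trans (×-homo-+ 1# a (m ℕ.* b))
    (+-cong (sym (*-identityˡ _)) (trans (×1-homo-* m b) (*-congʳ (sym ([x]1 (+ m))))))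

  stirling₁-triangle : IsTriangle 1ʷ (λ n _ → [ + n ] 1×) (λ n k → fromℕ (stirling₁ n k))
  stirling₁-triangle = record
    { corner = +-identityʳ 1# ; top = λ _ → refl ; left = λ _ → refl
    ; step = λ n k → fromℕ-step (stirling₁ n k) n _ }

  stirling₂-triangle : IsTriangle 1ʷ (λ _ k → [ + k ] 1×) (λ n k → fromℕ (stirling₂ n k))
  stirling₂-triangle = record
    { corner = +-identityʳ 1# ; top = λ _ → refl ; left = λ _ → refl
    ; step = λ n k → fromℕ-step (stirling₂ n k) (suc k) _ }

  -- The expansion scheme shared by both formulas.

  ∑-cong : ∀ k n {f g : ℕ → Carrier} → (∀ j → f j ≈ g j) → ∑ k n f ≈ ∑ k n g
  ∑-cong k n f≈g = sum-cong-≋ {suc n ∸ k} λ i → f≈g (k ℕ.+ toℕ i)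

  ∑-from : ∀ {k n} f → k ≤ n → (∀ j → j < k → f j ≈ 0#) → ∑< (suc n) f ≈ ∑ k n f
  ∑-from f z≤n       f≈0 = refl
  ∑-from f (s≤s k≤n) f≈0 =
    trans (+-congʳ (f≈0 0 (s≤s z≤n))) (trans (+-identityˡ _) (∑-from (f ∘ suc) k≤n (λ j j<k → f≈0 (suc j) (s≤s j<k))))

  -- The conditions on `g` are those that `rescale` imposes on the composite of the two scaled
  -- triangles; the result has the weights of U, so `unique` identifies it with U.
  triangle-expansion :
    ∀ {v w U} {α β : ℕ → Carrier} {A B} a b (g : ℕ → ℕ → Carrier) → IsTriangle v w U →
    IsTriangle 1ʷ (λ n _ → α n) A → IsTriangle 1ʷ (λ _ k → β k) B →
    g 0 0 ≈ 1# → (∀ n k → g (suc n) (suc k) ≈ v n k * g n k) →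
    (∀ n k → k < n → g (suc n) (suc k) * (a * α n + b * β (suc k)) ≈ w n (suc k) * g n (suc k)) →
    ∀ n k → k ≤ n →
    U n k ≈ g n k * (∑[ j from k to n ] (a ^ (n ∸ j) * b ^ (j ∸ k) * A n j * B j k))
  triangle-expansion {U = U} {α} {β} {A} {B} a b g ▵U ▵A ▵B g₀ gᵛ gʷ n k k≤n = begin
    U n k
      ≈⟨ unique ▵U (rescale (compose (rescale-^ ▵A a) (rescale-^ ▵B b)) g g₀
           (λ n k → trans (*-identityʳ _) (gᵛ n k)) gʷ) n k ⟩
    g n k * ∑< (suc n) (λ j → (a ^ (n ∸ j) * A n j) * (b ^ (j ∸ k) * B j k))
      -- The terms with j < k vanish because B is zero above the diagonal.
      ≈⟨ *-congˡ (∑-from (λ j → (a ^ (n ∸ j) * A n j) * (b ^ (j ∸ k) * B j k)) k≤n λ j j<k →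
           trans (*-congˡ (trans (*-congˡ (IsTriangle.above ▵B j<k)) (zeroʳ _))) (zeroʳ _)) ⟩
    g n k * (∑[ j from k to n ] ((a ^ (n ∸ j) * A n j) * (b ^ (j ∸ k) * B j k)))
      ≈⟨ *-congˡ (∑-cong k n λ j → solve 4 (λ x A y B → (x :* A) :* (y :* B) := x :* y :* A :* B) refl
           (a ^ (n ∸ j)) (A n j) (b ^ (j ∸ k)) (B j k)) ⟩
    g n k * (∑[ j from k to n ] (a ^ (n ∸ j) * b ^ (j ∸ k) * A n j * B j k))
      ∎

  -- The formula for general q.

  S-expansion : ∀ (s : ℕ) (h q : K×) (n k : ℕ) → k ≤ n →
    S s (↑ h) q n k
      ≈ (↑ h) ^ (n ∸ k)
        * ↑ (q ^ᶻ (+ s ℤ.* + (n C 2) ℤ.- (+ s ℤ.- + 1) ℤ.* + (k C 2) ℤ.- + n ℤ.+ + k))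
        * (∑[ j from k to n ]
            (([ + s ] (q ⁻¹)) ^ (n ∸ j)
             * (- ([ + s ℤ.- + 1 ] (q ⁻¹))) ^ (j ∸ k)
             * ĉ ((q ^ᶻ (+ s)) ⁻¹) n j
             * Ŝ ((q ^ᶻ (+ s ℤ.- + 1)) ⁻¹) j k))
  S-expansion s h q = triangle-expansion _ _ g (S-triangle s (↑ h) q) (ĉ-triangle _) (Ŝ-triangle _) g₀ gᵛ gʷ
    where
    σ τ : ℤ
    σ = + s
    τ = + s ℤ.- + 1

    p P R : K×
    p = q ⁻¹
    P = (q ^ᶻ σ) ⁻¹
    R = (q ^ᶻ τ) ⁻¹

    e : ℕ → ℕ → ℤ
    e n k = σ ℤ.* + (n C 2) ℤ.- τ ℤ.* + (k C 2) ℤ.- + n ℤ.+ + k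

    x : ℕ → ℕ → ℤ
    x n k = σ ℤ.* + n ℤ.- τ ℤ.* + k

    g : ℕ → ℕ → Carrier
    g n k = ↑ h ^ (n ∸ k) * ↑ (q ^ᶻ e n k)

    e-diagonal : ∀ n k → e (suc n) (suc k) ≡ x n k ℤ.+ e n k
    e-diagonal n k = ≡.trans
      (≡.cong₂ (λ c d → σ ℤ.* c ℤ.- τ ℤ.* d ℤ.- + suc n ℤ.+ + suc k) (binomial₂-suc n) (binomial₂-suc k))
      (identity σ τ (+ n) (+ k) (+ (n C 2)) (+ (k C 2)))
      where
      identity : ∀ σ τ n k c d →
        σ ℤ.* (n ℤ.+ c) ℤ.- τ ℤ.* (k ℤ.+ d) ℤ.- (+ 1 ℤ.+ n) ℤ.+ (+ 1 ℤ.+ k)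
          ≡ (σ ℤ.* n ℤ.- τ ℤ.* k) ℤ.+ (σ ℤ.* c ℤ.- τ ℤ.* d ℤ.- n ℤ.+ k)
      identity = solve-∀

    -- The increment is just s n. Splitting it as x + τ k yields one power of q for `[⁻¹]` and one
    -- that cancels the power of 1/q coming from `weight`.
    e-row : ∀ n k → ℤ.suc (e (suc n) k) ≡ (x n k ℤ.+ τ ℤ.* + k) ℤ.+ e n k
    e-row n k = ≡.trans
      (≡.cong (λ c → ℤ.suc (σ ℤ.* c ℤ.- τ ℤ.* + (k C 2) ℤ.- + suc n ℤ.+ + k)) (binomial₂-suc n))
      (identity σ τ (+ n) (+ k) (+ (n C 2)) (+ (k C 2)))
      where
      identity : ∀ σ τ n k c d →
        + 1 ℤ.+ (σ ℤ.* (n ℤ.+ c) ℤ.- τ ℤ.* d ℤ.- (+ 1 ℤ.+ n) ℤ.+ k)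
          ≡ ((σ ℤ.* n ℤ.- τ ℤ.* k) ℤ.+ τ ℤ.* k) ℤ.+ (σ ℤ.* c ℤ.- τ ℤ.* d ℤ.- n ℤ.+ k)
      identity = solve-∀

    g₀ : g 0 0 ≈ 1#
    g₀ = trans (*-identityˡ _) (reflexive (≡.cong (λ z → ↑ (q ^ᶻ z)) (vanish σ τ)))
      where
      vanish : ∀ σ τ → σ ℤ.* + 0 ℤ.- τ ℤ.* + 0 ℤ.- + 0 ℤ.+ + 0 ≡ + 0
      vanish = solve-∀

    gᵛ : ∀ n k → g (suc n) (suc k) ≈ ↑ (q ^ᶻ x n k) * g n k
    gᵛ n k = begin
      ↑ h ^ (n ∸ k) * ↑ (q ^ᶻ e (suc n) (suc k))
        ≡⟨ ≡.cong (λ z → ↑ h ^ (n ∸ k) * ↑ (q ^ᶻ z)) (e-diagonal n k) ⟩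
      ↑ h ^ (n ∸ k) * ↑ (q ^ᶻ (x n k ℤ.+ e n k))
        ≈⟨ *-congˡ (^ᶻ-+ q (x n k) (e n k)) ⟩
      ↑ h ^ (n ∸ k) * (↑ (q ^ᶻ x n k) * ↑ (q ^ᶻ e n k))
        ≈⟨ solve 3 (λ a b c → a :* (b :* c) := b :* (a :* c)) refl _ _ _ ⟩
      ↑ (q ^ᶻ x n k) * g n k
        ∎

    gʷ : ∀ n k → k < n →
         g (suc n) (suc k) * ([ σ ] p * [ + n ] P + - [ τ ] p * [ + suc k ] R)
           ≈ (↑ h * [ x n (suc k) ] q) * g n (suc k)
    -- Both `row` and `[⁻¹]` carry an extra factor q; multiplying through by q lets them apply as
    -- they stand.
    gʷ n k k<n = *-cancelˡ q (begin
      ↑ q * (↑ h ^ (n ∸ k) * Q′ * ([ σ ] p * [ + n ] P + - [ τ ] p * [ + suc k ] R))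
        ≈⟨ *-congˡ (*-cong (*-congʳ (reflexive (≡.cong (↑ h ^_) (ℕ.+-∸-assoc 1 k<n))))
             (weight p σ τ P R (^ᶻ-⁻¹ q σ) (^ᶻ-⁻¹ q τ) n (suc k))) ⟩
      ↑ q * (↑ h * H * Q′ * (V * Y))
        ≈⟨ solve 6 (λ q h H Q V Y → q :* (h :* H :* Q :* (V :* Y)) := h :* H :* (q :* Q) :* (V :* Y)) refl _ _ _ _ _ _ ⟩
      ↑ h * H * (↑ q * Q′) * (V * Y)
        ≈⟨ *-congʳ (*-congˡ row) ⟩
      ↑ h * H * ((X * U) * Q) * (V * Y)
        ≈⟨ solve 7 (λ h H X U Q V Y → h :* H :* ((X :* U) :* Q) :* (V :* Y)
                      := (U :* V) :* (h :* (X :* Y) :* (H :* Q))) refl _ _ _ _ _ _ _ ⟩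
      (U * V) * (↑ h * (X * Y) * (H * Q))
        ≈⟨ trans (*-congʳ (^ᶻ-⁻¹-inverse q (τ ℤ.* + suc k))) (*-identityˡ _) ⟩
      ↑ h * (X * Y) * (H * Q)
        ≈⟨ *-congʳ (*-congˡ ([⁻¹] q (x n (suc k)))) ⟨
      ↑ h * (↑ q * [ x n (suc k) ] q) * (H * Q)
        ≈⟨ solve 4 (λ h q y g → h :* (q :* y) :* g := q :* (h :* y :* g)) refl _ _ _ _ ⟩
      ↑ q * (↑ h * [ x n (suc k) ] q * (H * Q))
        ∎)
      where
      H Q Q′ U V X Y : Carrier
      H  = ↑ h ^ (n ∸ suc k)
      Q  = ↑ (q ^ᶻ e n (suc k))
      Q′ = ↑ (q ^ᶻ e (suc n) (suc k))
      U  = ↑ (q ^ᶻ (τ ℤ.* + suc k))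
      V  = ↑ (p ^ᶻ (τ ℤ.* + suc k))
      X  = ↑ (q ^ᶻ x n (suc k))
      Y  = [ x n (suc k) ] p

      row : ↑ q * Q′ ≈ (X * U) * Q
      row = begin
        ↑ q * Q′
          ≈⟨ ^ᶻ-suc q (e (suc n) (suc k)) ⟨
        ↑ (q ^ᶻ ℤ.suc (e (suc n) (suc k)))
          ≡⟨ ≡.cong (λ z → ↑ (q ^ᶻ z)) (e-row n (suc k)) ⟩
        ↑ (q ^ᶻ ((x n (suc k) ℤ.+ τ ℤ.* + suc k) ℤ.+ e n (suc k)))
          ≈⟨ trans (^ᶻ-+ q (x n (suc k) ℤ.+ τ ℤ.* + suc k) (e n (suc k))) (*-congʳ (^ᶻ-+ q (x n (suc k)) (τ ℤ.* + suc k))) ⟩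
        (X * U) * Q
          ∎

  -- The classical formula at q = 1.

  S-expansion₁ : ∀ (s : ℕ) (h : K×) (n k : ℕ) → k ≤ n →
    S s (↑ h) 1× n k
      ≈ (↑ h) ^ (n ∸ k)
        * (∑[ j from k to n ]
            (fromℕ s ^ (n ∸ j)
             * (1# - fromℕ s) ^ (j ∸ k)
             * fromℕ (stirling₁ n j)
             * fromℕ (stirling₂ j k)))
  -- The Stirling arrays enter the scheme directly, without specialising the general formula. Powers
  -- of 1 are 1, so the prefactor is a power of h alone.
  S-expansion₁ s h = triangle-expansion _ _ g (S-triangle s (↑ h) 1×) stirling₁-triangle stirling₂-triangle
    refl (λ n k → sym (trans (*-congʳ (1^ᶻ (x n k))) (*-identityˡ _))) gʷ
    where
    σ τ : ℤ
    σ = + s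
    τ = + s ℤ.- + 1

    x : ℕ → ℕ → ℤ
    x n k = σ ℤ.* + n ℤ.- τ ℤ.* + k

    g : ℕ → ℕ → Carrier
    g n k = ↑ h ^ (n ∸ k)

    -- This gives the factor the shape that `weight` expects. The recurrence `[suc]` holds at every
    -- integer, so s = 0, where τ = -1, is included.
    1-s : 1# - fromℕ s ≈ - [ τ ] 1×
    1-s = begin
      1# - fromℕ s              ≈⟨ +-congˡ (-‿cong ([x]1 σ)) ⟨
      1# - [ σ ] 1×             ≡⟨ ≡.cong (λ z → 1# - [ z ] 1×) (σ≡1+τ σ) ⟩
      1# - [ ℤ.suc τ ] 1×       ≈⟨ +-congˡ (-‿cong (trans ([suc] 1× τ) (+-congˡ (*-identityˡ _)))) ⟩
      1# - (1# + [ τ ] 1×)      ≈⟨ +-congˡ (-‿+-comm 1# _) ⟨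
      1# + (- 1# - [ τ ] 1×)    ≈⟨ +-assoc _ _ _ ⟨
      1# - 1# - [ τ ] 1×        ≈⟨ trans (+-congʳ (-‿inverseʳ 1#)) (+-identityˡ _) ⟩
      - [ τ ] 1×                ∎
      where
      σ≡1+τ : ∀ σ → σ ≡ + 1 ℤ.+ (σ ℤ.- + 1)
      σ≡1+τ = solve-∀

    1≈1^ᶻ : ∀ x → 1# ≈ ↑ (1× ^ᶻ x)
    1≈1^ᶻ x = sym (1^ᶻ x)

    gʷ : ∀ n k → k < n →
         g (suc n) (suc k) * (fromℕ s * [ + n ] 1× + (1# - fromℕ s) * [ + suc k ] 1×)
           ≈ (↑ h * [ x n (suc k) ] 1×) * g n (suc k)
    gʷ n k k<n = begin
      ↑ h ^ (n ∸ k) * (fromℕ s * [ + n ] 1× + (1# - fromℕ s) * [ + suc k ] 1×)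
        ≈⟨ *-cong (reflexive (≡.cong (↑ h ^_) (ℕ.+-∸-assoc 1 k<n)))
             (+-cong (*-congʳ (sym ([x]1 σ))) (*-congʳ 1-s)) ⟩
      ↑ h * g n (suc k) * ([ σ ] 1× * [ + n ] 1× + - [ τ ] 1× * [ + suc k ] 1×)
        ≈⟨ *-congˡ (trans (weight 1× σ τ 1× 1× (1≈1^ᶻ σ) (1≈1^ᶻ τ) n (suc k))
             (trans (*-congʳ (1^ᶻ (τ ℤ.* + suc k))) (*-identityˡ _))) ⟩
      ↑ h * g n (suc k) * [ x n (suc k) ] 1×
        ≈⟨ solve 3 (λ h g y → h :* g :* y := h :* y :* g) refl _ _ _ ⟩
      ↑ h * [ x n (suc k) ] 1× * g n (suc k)
        ∎

corollary3 : ∀ {c ℓ₁ ℓ₂} (K : HeytingField c ℓ₁ ℓ₂) (_#?_ : Decidable (HeytingField._#_ K)) →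
    let open QStirling K _#?_ in
    (∀ (s : ℕ) (h q : K×) (n k : ℕ) → k ≤ n →
      S s (↑ h) q n k
        ≈ (↑ h) ^ (n ∸ k)
          * ↑ (q ^ᶻ (+ s ℤ.* + (n C 2) ℤ.- (+ s ℤ.- + 1) ℤ.* + (k C 2) ℤ.- + n ℤ.+ + k))
          * (∑[ j from k to n ]
              (([ + s ] (q ⁻¹)) ^ (n ∸ j)
               * (- ([ + s ℤ.- + 1 ] (q ⁻¹))) ^ (j ∸ k)
               * ĉ ((q ^ᶻ (+ s)) ⁻¹) n j
               * Ŝ ((q ^ᶻ (+ s ℤ.- + 1)) ⁻¹) j k)))
    ∧
    (∀ (s : ℕ) (h : K×) (n k : ℕ) → k ≤ n →
      S s (↑ h) 1× n k
        ≈ (↑ h) ^ (n ∸ k)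
          * (∑[ j from k to n ]
              (fromℕ s ^ (n ∸ j)
               * (1# - fromℕ s) ^ (j ∸ k)
               * fromℕ (stirling₁ n j)
               * fromℕ (stirling₂ j k))))
corollary3 K _#?_ = S-expansion K _#?_ , S-expansion₁ K _#?_
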